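{- Let $\mathcal E$ be an elementary topos with subobject classifier $\top:1\to\Omega$. The commutative triangle consisting of the (domain) fibrations $\mathcal E_{/1}\to\mathcal E$ and $\omega:\mathcal E_{/\Omega}\to\mathcal E$ and the functor $\Sigma_\top:\mathcal E_{/1}\to\mathcal E_{/\Omega}$ given by composition with $\top$, together with the functor $\Delta_\top:\mathcal E_{/\Omega}\to\mathcal E_{/1}$ given by pullback along $\top$, is a plain dependent type theory; in particular $\Sigma_\top\dashv\Delta_\top$.
   Context: Plain dependent type theory (pDTT): a category $\mathbf{ctx}$ (with terminal object), fibrations $u:\mathcal U\to\mathbf{ctx}$ and $\dot u:\dot{\mathcal U}\to\mathbf{ctx}$, a functor $\Sigma:\dot{\mathcal U}\to\mathcal U$ with $u\Sigma=\dot u$, and a right adjoint $\Delta:\mathcal U\to\dot{\mathcal U}$ of $\Sigma$ (not required to commute with the projections to $\mathbf{ctx}$), with unit $\eta$ and counit $\epsilon$, such that $\Sigma$ and $\Delta$ preserve cartesian morphisms and the components of $\eta$ and $\epsilon$ are cartesian (for $\dot u$ and $u$ respectively). $\Delta_\top$ sends $\phi:X\to\Omega$ to the pullback object $\{x\mid\phi(x)\}$ of $\top$ along $\phi$. -}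

module Defs where

open import Level using (Level; _⊔_; suc)
open import Data.Product using (Σ-syntax; _×_)
open import Relation.Binary.PropositionalEquality using (_≡_; refl)
open import Relation.Binary.Structures using (IsEquivalence)

-- Morphisms between two fixed objects form a setoid; equality of objects is
-- propositional equality.
record Category (o ℓ e : Level) : Set (suc (o ⊔ ℓ ⊔ e)) where
  infix  4 _≈_ _⇒_
  infixr 9 _∘_
  field
    Obj : Set o
    _⇒_ : Obj → Obj → Set ℓ
    _≈_ : {A B : Obj} → A ⇒ B → A ⇒ B → Set e
    id  : {A : Obj} → A ⇒ A
    _∘_ : {A B C : Obj} → B ⇒ C → A ⇒ B → A ⇒ C

    equiv     : {A B : Obj} → IsEquivalence (_≈_ {A} {B})
    assoc     : {A B C D : Obj} {f : A ⇒ B} {g : B ⇒ C} {h : C ⇒ D} →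
                (h ∘ g) ∘ f ≈ h ∘ (g ∘ f)
    identityˡ : {A B : Obj} {f : A ⇒ B} → id ∘ f ≈ f
    identityʳ : {A B : Obj} {f : A ⇒ B} → f ∘ id ≈ f
    ∘-resp-≈  : {A B C : Obj} {f h : B ⇒ C} {g i : A ⇒ B} →
                f ≈ h → g ≈ i → f ∘ g ≈ h ∘ i

  module Eq {A B : Obj} = IsEquivalence (equiv {A} {B})

  idToHom : {A B : Obj} → A ≡ B → A ⇒ B
  idToHom refl = id

record Functor {o ℓ e o′ ℓ′ e′ : Level}
               (C : Category o ℓ e) (D : Category o′ ℓ′ e′) :
               Set (o ⊔ ℓ ⊔ e ⊔ o′ ⊔ ℓ′ ⊔ e′) where
  private
    module C = Category C
    module D = Category D
  field
    F₀ : C.Obj → D.Obj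
    F₁ : {A B : C.Obj} → A C.⇒ B → F₀ A D.⇒ F₀ B

    identity     : {A : C.Obj} → F₁ (C.id {A}) D.≈ D.id
    homomorphism : {X Y Z : C.Obj} {f : X C.⇒ Y} {g : Y C.⇒ Z} →
                   F₁ (g C.∘ f) D.≈ F₁ g D.∘ F₁ f
    F-resp-≈     : {A B : C.Obj} {f g : A C.⇒ B} → f C.≈ g → F₁ f D.≈ F₁ g

idF : {o ℓ e : Level} {C : Category o ℓ e} → Functor C C
idF {C = C} = record
  { F₀           = λ A → A
  ; F₁           = λ f → f
  ; identity     = Eq.refl
  ; homomorphism = Eq.refl
  ; F-resp-≈     = λ p → p
  }
  where open Category C

infixr 9 _∘F_

_∘F_ : {o ℓ e o′ ℓ′ e′ o″ ℓ″ e″ : Level}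
       {C : Category o ℓ e} {D : Category o′ ℓ′ e′} {E : Category o″ ℓ″ e″} →
       Functor D E → Functor C D → Functor C E
_∘F_ {E = E} G F = record
  { F₀           = λ A → G.F₀ (F.F₀ A)
  ; F₁           = λ f → G.F₁ (F.F₁ f)
  ; identity     = Eq.trans (G.F-resp-≈ F.identity) G.identity
  ; homomorphism = Eq.trans (G.F-resp-≈ F.homomorphism) G.homomorphism
  ; F-resp-≈     = λ p → G.F-resp-≈ (F.F-resp-≈ p)
  }
  where
    open Category E
    module F = Functor F
    module G = Functor G

infix 4 _≡F_

-- Strict equality of functors. Arrows with merely propositionally equal
-- endpoints are compared after composing with the transported identities.
record _≡F_ {o ℓ e o′ ℓ′ e′ : Level}
            {C : Category o ℓ e} {D : Category o′ ℓ′ e′}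
            (F G : Functor C D) : Set (o ⊔ ℓ ⊔ o′ ⊔ e′) where
  private
    module C = Category C
    module F = Functor F
    module G = Functor G
  open Category D
  field
    eq₀ : (X : C.Obj) → F.F₀ X ≡ G.F₀ X
    eq₁ : {X Y : C.Obj} (f : X C.⇒ Y) →
          idToHom (eq₀ Y) ∘ F.F₁ f ≈ G.F₁ f ∘ idToHom (eq₀ X)

record NaturalTransformation {o ℓ e o′ ℓ′ e′ : Level}
                             {C : Category o ℓ e} {D : Category o′ ℓ′ e′}
                             (F G : Functor C D) : Set (o ⊔ ℓ ⊔ ℓ′ ⊔ e′) where
  private
    module C = Category C
    module F = Functor F
    module G = Functor G
  open Category D
  field
    component : (X : C.Obj) → F.F₀ X ⇒ G.F₀ X
    commute   : {X Y : C.Obj} (f : X C.⇒ Y) →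
                component Y ∘ F.F₁ f ≈ G.F₁ f ∘ component X

infix 4 _⊣_

record _⊣_ {o ℓ e o′ ℓ′ e′ : Level}
           {C : Category o ℓ e} {D : Category o′ ℓ′ e′}
           (L : Functor C D) (R : Functor D C) :
           Set (o ⊔ ℓ ⊔ e ⊔ o′ ⊔ ℓ′ ⊔ e′) where
  private
    module C = Category C
    module D = Category D
    module L = Functor L
    module R = Functor R
  field
    unit   : NaturalTransformation idF (R ∘F L)
    counit : NaturalTransformation (L ∘F R) idF

  module η = NaturalTransformation unit
  module ε = NaturalTransformation counit

  field
    zig : (A : C.Obj) → ε.component (L.F₀ A) D.∘ L.F₁ (η.component A) D.≈ D.id
    zag : (B : D.Obj) → R.F₁ (ε.component B) C.∘ η.component (R.F₀ B) C.≈ C.id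

module _ {o ℓ e o′ ℓ′ e′ : Level}
         {U : Category o ℓ e} {B : Category o′ ℓ′ e′}
         (p : Functor U B) where
  private
    module U = Category U
    module B = Category B
    module p = Functor p

  IsCartesian : {X Y : U.Obj} → X U.⇒ Y → Set (o ⊔ ℓ ⊔ e ⊔ ℓ′ ⊔ e′)
  IsCartesian {X} {Y} φ =
    {Z : U.Obj} (ψ : Z U.⇒ Y) (g : p.F₀ Z B.⇒ p.F₀ X) →
    p.F₁ φ B.∘ g B.≈ p.F₁ ψ →
    Σ[ h ∈ Z U.⇒ X ]
      ((φ U.∘ h U.≈ ψ) × (p.F₁ h B.≈ g)) ×
      ((k : Z U.⇒ X) → φ U.∘ k U.≈ ψ → p.F₁ k B.≈ g → k U.≈ h)

  record CartesianLift {I : B.Obj} (X : U.Obj) (f : I B.⇒ p.F₀ X) :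
                       Set (o ⊔ ℓ ⊔ e ⊔ o′ ⊔ ℓ′ ⊔ e′) where
    field
      source    : U.Obj
      over      : p.F₀ source ≡ I
      arrow     : source U.⇒ X
      lifts     : p.F₁ arrow B.≈ f B.∘ B.idToHom over
      cartesian : IsCartesian arrow

  IsFibration : Set (o ⊔ ℓ ⊔ e ⊔ o′ ⊔ ℓ′ ⊔ e′)
  IsFibration = {I : B.Obj} (X : U.Obj) (f : I B.⇒ p.F₀ X) → CartesianLift X f

PreservesCartesian : {o ℓ e o′ ℓ′ e′ o″ ℓ″ e″ : Level}
                     {U : Category o ℓ e} {V : Category o′ ℓ′ e′}
                     {B : Category o″ ℓ″ e″}
                     (p : Functor U B) (q : Functor V B) (F : Functor U V) →
                     Set (o ⊔ ℓ ⊔ e ⊔ o′ ⊔ ℓ′ ⊔ e′ ⊔ ℓ″ ⊔ e″)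
PreservesCartesian {U = U} p q F =
  {X Y : U.Obj} (φ : X U.⇒ Y) → IsCartesian p φ → IsCartesian q (Functor.F₁ F φ)
  where module U = Category U

module _ {o ℓ e : Level} (C : Category o ℓ e) where
  open Category C

  record Terminal : Set (o ⊔ ℓ ⊔ e) where
    field
      𝟙        : Obj
      !        : {A : Obj} → A ⇒ 𝟙
      !-unique : {A : Obj} (f : A ⇒ 𝟙) → f ≈ !

  record Product (A B : Obj) : Set (o ⊔ ℓ ⊔ e) where
    field
      A×B      : Obj
      π₁       : A×B ⇒ A
      π₂       : A×B ⇒ B
      ⟨_,_⟩    : {Z : Obj} → Z ⇒ A → Z ⇒ B → Z ⇒ A×B
      project₁ : {Z : Obj} {f : Z ⇒ A} {g : Z ⇒ B} → π₁ ∘ ⟨ f , g ⟩ ≈ f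
      project₂ : {Z : Obj} {f : Z ⇒ A} {g : Z ⇒ B} → π₂ ∘ ⟨ f , g ⟩ ≈ g
      unique   : {Z : Obj} {f : Z ⇒ A} {g : Z ⇒ B} {h : Z ⇒ A×B} →
                 π₁ ∘ h ≈ f → π₂ ∘ h ≈ g → h ≈ ⟨ f , g ⟩

  record IsPullback {P X Y Z : Obj}
                    (p₁ : P ⇒ X) (p₂ : P ⇒ Y) (f : X ⇒ Z) (g : Y ⇒ Z) :
                    Set (o ⊔ ℓ ⊔ e) where
    field
      commute   : f ∘ p₁ ≈ g ∘ p₂
      universal : {Q : Obj} {h₁ : Q ⇒ X} {h₂ : Q ⇒ Y} →
                  f ∘ h₁ ≈ g ∘ h₂ → Q ⇒ P
      p₁∘universal≈h₁ : {Q : Obj} {h₁ : Q ⇒ X} {h₂ : Q ⇒ Y}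
                        {eq : f ∘ h₁ ≈ g ∘ h₂} → p₁ ∘ universal eq ≈ h₁
      p₂∘universal≈h₂ : {Q : Obj} {h₁ : Q ⇒ X} {h₂ : Q ⇒ Y}
                        {eq : f ∘ h₁ ≈ g ∘ h₂} → p₂ ∘ universal eq ≈ h₂
      unique    : {Q : Obj} {h₁ : Q ⇒ X} {h₂ : Q ⇒ Y} {k : Q ⇒ P}
                  {eq : f ∘ h₁ ≈ g ∘ h₂} →
                  p₁ ∘ k ≈ h₁ → p₂ ∘ k ≈ h₂ → k ≈ universal eq

  record Pullback {X Y Z : Obj} (f : X ⇒ Z) (g : Y ⇒ Z) : Set (o ⊔ ℓ ⊔ e) where
    field
      P          : Obj
      p₁         : P ⇒ X
      p₂         : P ⇒ Y
      isPullback : IsPullback p₁ p₂ f g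
    open IsPullback isPullback public

  Mono : {A B : Obj} → A ⇒ B → Set (o ⊔ ℓ ⊔ e)
  Mono {A} f = {Z : Obj} (g h : Z ⇒ A) → f ∘ g ≈ f ∘ h → g ≈ h

  record SubobjectClassifier (terminal : Terminal) : Set (o ⊔ ℓ ⊔ e) where
    open Terminal terminal
    field
      Ω     : Obj
      true  : 𝟙 ⇒ Ω
      χ     : {S X : Obj} (m : S ⇒ X) → Mono m → X ⇒ Ω
      χ-isPullback : {S X : Obj} (m : S ⇒ X) (mono : Mono m) →
                     IsPullback m ! (χ m mono) true
      χ-unique     : {S X : Obj} (m : S ⇒ X) (mono : Mono m) {c : X ⇒ Ω} →
                     IsPullback m ! c true → c ≈ χ m mono

  module _ (product : (A B : Obj) → Product A B) where
    private module × (A B : Obj) = Product (product A B)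

    record Exponential (A B : Obj) : Set (o ⊔ ℓ ⊔ e) where
      field
        B^A    : Obj
        eval   : ×.A×B B^A A ⇒ B
        curry  : {Z : Obj} → ×.A×B Z A ⇒ B → Z ⇒ B^A
        β      : {Z : Obj} {g : ×.A×B Z A ⇒ B} →
                 eval ∘ ×.⟨_,_⟩ B^A A (curry g ∘ ×.π₁ Z A) (×.π₂ Z A) ≈ g
        unique : {Z : Obj} {g : ×.A×B Z A ⇒ B} {h : Z ⇒ B^A} →
                 eval ∘ ×.⟨_,_⟩ B^A A (h ∘ ×.π₁ Z A) (×.π₂ Z A) ≈ g →
                 h ≈ curry g

  -- Finite limits (chosen), exponentials and a subobject classifier.
  -- A terminal object and pullbacks yield all finite limits; the binary
  -- products are listed because the exponentials refer to them.
  record ElementaryTopos : Set (o ⊔ ℓ ⊔ e) where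
    field
      terminal    : Terminal
      product     : (A B : Obj) → Product A B
      pullback    : {X Y Z : Obj} (f : X ⇒ Z) (g : Y ⇒ Z) → Pullback f g
      exponential : (A B : Obj) → Exponential product A B
      classifier  : SubobjectClassifier terminal
    open Terminal terminal public
    open SubobjectClassifier classifier public

module _ {o ℓ e : Level} (C : Category o ℓ e) where
  open Category C

  record SliceObj (A : Obj) : Set (o ⊔ ℓ) where
    constructor sliceobj
    field
      {dom} : Obj
      arr   : dom ⇒ A

  record SliceHom {A : Obj} (X Y : SliceObj A) : Set (ℓ ⊔ e) where
    constructor slicehom
    private
      module X = SliceObj X
      module Y = SliceObj Y
    field
      {hom}    : X.dom ⇒ Y.dom
      triangle : Y.arr ∘ hom ≈ X.arr

  Slice : Obj → Category (o ⊔ ℓ) (ℓ ⊔ e) e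
  Slice A = record
    { Obj       = SliceObj A
    ; _⇒_       = SliceHom
    ; _≈_       = λ f g → SliceHom.hom f ≈ SliceHom.hom g
    ; id        = slicehom identityʳ
    ; _∘_       = λ (slicehom p) (slicehom q) →
                    slicehom (Eq.trans (Eq.sym assoc)
                             (Eq.trans (∘-resp-≈ p Eq.refl) q))
    ; equiv     = record { refl = Eq.refl ; sym = Eq.sym ; trans = Eq.trans }
    ; assoc     = assoc
    ; identityˡ = identityˡ
    ; identityʳ = identityʳ
    ; ∘-resp-≈  = ∘-resp-≈
    }

  domF : (A : Obj) → Functor (Slice A) C
  domF A = record
    { F₀           = SliceObj.dom
    ; F₁           = SliceHom.hom
    ; identity     = Eq.refl
    ; homomorphism = Eq.refl
    ; F-resp-≈     = λ p → p
    }

  composeF : {A B : Obj} → A ⇒ B → Functor (Slice A) (Slice B)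
  composeF f = record
    { F₀           = λ (sliceobj x) → sliceobj (f ∘ x)
    ; F₁           = λ (slicehom t) →
                       slicehom (Eq.trans assoc (∘-resp-≈ Eq.refl t))
    ; identity     = Eq.refl
    ; homomorphism = Eq.refl
    ; F-resp-≈     = λ p → p
    }

  pullbackF : ({X Y Z : Obj} (f : X ⇒ Z) (g : Y ⇒ Z) → Pullback C f g) →
              {A B : Obj} → A ⇒ B → Functor (Slice B) (Slice A)
  pullbackF pullback {A} {B} f = record
    { F₀           = λ (sliceobj x) → sliceobj (Pullback.p₂ (pullback x f))
    ; F₁           = F₁
    ; identity     = λ {X} → Eq.sym (unique X
                       (Eq.trans identityʳ (Eq.sym identityˡ)) identityʳ)
    ; homomorphism = λ {X} {Y} {Z} {g} {h} → Eq.sym (unique Z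
                       (Eq.trans (Eq.sym assoc)
                       (Eq.trans (∘-resp-≈ (p₁-F₁ h) Eq.refl)
                       (Eq.trans assoc
                       (Eq.trans (∘-resp-≈ Eq.refl (p₁-F₁ g))
                       (Eq.sym assoc)))))
                       (Eq.trans (Eq.sym assoc)
                       (Eq.trans (∘-resp-≈ (p₂-F₁ h) Eq.refl) (p₂-F₁ g))))
    ; F-resp-≈     = λ {X} {Y} {g} {h} p → unique Y
                       (Eq.trans (p₁-F₁ g) (∘-resp-≈ p Eq.refl)) (p₂-F₁ g)
    }
    where
      module PB (X : SliceObj B) = Pullback (pullback (SliceObj.arr X) f)
      open PB

      square : {X Y : SliceObj B} (h : SliceHom X Y) →
               SliceObj.arr Y ∘ (SliceHom.hom h ∘ p₁ X) ≈ f ∘ p₂ X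
      square {X} (slicehom t) =
        Eq.trans (Eq.sym assoc) (Eq.trans (∘-resp-≈ t Eq.refl) (commute X))

      F₁ : {X Y : SliceObj B} → SliceHom X Y →
           SliceHom (sliceobj (p₂ X)) (sliceobj (p₂ Y))
      F₁ {X} {Y} h =
        slicehom {hom = universal Y (square h)} (p₂∘universal≈h₂ Y)

      p₁-F₁ : {X Y : SliceObj B} (h : SliceHom X Y) →
              p₁ Y ∘ SliceHom.hom (F₁ h) ≈ SliceHom.hom h ∘ p₁ X
      p₁-F₁ {_} {Y} h = p₁∘universal≈h₁ Y

      p₂-F₁ : {X Y : SliceObj B} (h : SliceHom X Y) →
              p₂ Y ∘ SliceHom.hom (F₁ h) ≈ p₂ X
      p₂-F₁ {_} {Y} h = p₂∘universal≈h₂ Y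

record IsPlainDTT {o ℓ e o′ ℓ′ e′ o″ ℓ″ e″ : Level}
                  {ctx : Category o ℓ e}
                  {U  : Category o′ ℓ′ e′}
                  {U̇  : Category o″ ℓ″ e″}
                  (u  : Functor U ctx)
                  (u̇  : Functor U̇ ctx)
                  (Σᵤ : Functor U̇ U)
                  (Δᵤ : Functor U U̇) :
                  Set (o ⊔ ℓ ⊔ e ⊔ o′ ⊔ ℓ′ ⊔ e′ ⊔ o″ ⊔ ℓ″ ⊔ e″) where
  private
    module U = Category U
    module U̇ = Category U̇
  field
    ctx-terminal : Terminal ctx
    u-fibration  : IsFibration u
    u̇-fibration  : IsFibration u̇
    uΣ≡u̇         : u ∘F Σᵤ ≡F u̇
    Σ⊣Δ          : Σᵤ ⊣ Δᵤ
    Σ-cartesian  : PreservesCartesian u̇ u Σᵤ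
    Δ-cartesian  : PreservesCartesian u u̇ Δᵤ

  open _⊣_ Σ⊣Δ

  field
    η-cartesian : (X : U̇.Obj) → IsCartesian u̇ (η.component X)
    ε-cartesian : (X : U.Obj) → IsCartesian u (ε.component X)

-- A domain functor C/A → C is a discrete fibration, so every arrow of C/A is
-- cartesian; what remains is the adjunction of composition and pullback along
-- true.

{-# OPTIONS --safe #-}
module Submission where

open import Defs
open import Data.Product using (_,_)
open import Relation.Binary.Bundles using (Setoid)
import Relation.Binary.Reasoning.Setoid as SetoidReasoning
open import Relation.Binary.PropositionalEquality using (refl)

-- An arrow of a slice is an arrow of the base satisfying a triangle, and slice equality ignores the
-- triangle. Hence cartesian fillers are unique, and they exist because the required triangle
-- follows from those of the given arrows (`domF-allCartesian`). This settles every condition on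
-- cartesian arrows. The remaining content is the adjunction, which holds for any `f` in a category
-- with pullbacks; the theorem is the case `f = true`.

module _ {o ℓ e} (C : Category o ℓ e) where
  open Category C

  homSetoid : (A B : Obj) → Setoid ℓ e
  homSetoid A B = record { Carrier = A ⇒ B ; _≈_ = _≈_ ; isEquivalence = equiv }

  private
    module Reasoning {A B : Obj} = SetoidReasoning (homSetoid A B)
  open Reasoning

  domF-allCartesian : (A : Obj) {X Y : SliceObj C A} (φ : SliceHom C X Y) →
                      IsCartesian (domF C A) φ
  domF-allCartesian A {X} {Y} (slicehom {φ} φ-tri) {Z} (slicehom {ψ} ψ-tri) g φg≈ψ =
    -- The filler is `g` itself; lying over `g` already forces uniqueness.
    slicehom g-tri , (φg≈ψ , Eq.refl) , λ _ _ k≈g → k≈g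
    where
      module X = SliceObj X
      module Y = SliceObj Y
      module Z = SliceObj Z

      g-tri : X.arr ∘ g ≈ Z.arr
      g-tri = begin
        X.arr ∘ g        ≈⟨ ∘-resp-≈ φ-tri Eq.refl ⟨
        (Y.arr ∘ φ) ∘ g  ≈⟨ assoc ⟩
        Y.arr ∘ (φ ∘ g)  ≈⟨ ∘-resp-≈ Eq.refl φg≈ψ ⟩
        Y.arr ∘ ψ        ≈⟨ ψ-tri ⟩
        Z.arr            ∎

  domF-isFibration : (A : Obj) → IsFibration (domF C A)
  domF-isFibration A X f = record
    { source    = sliceobj (SliceObj.arr X ∘ f)
    ; over      = refl
    ; arrow     = lift
    ; lifts     = Eq.sym identityʳ
    ; cartesian = domF-allCartesian A lift
    }
    where
      lift : SliceHom C (sliceobj (SliceObj.arr X ∘ f)) X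
      lift = slicehom Eq.refl

  domF∘composeF : {A B : Obj} (f : A ⇒ B) → domF C B ∘F composeF C f ≡F domF C A
  domF∘composeF f = record
    { eq₀ = λ _ → refl
    ; eq₁ = λ _ → Eq.trans identityˡ (Eq.sym identityʳ)
    }

  -- Both `h` and `k` mediate the cone obtained by composing the projections with `k`.
  IsPullback-jointlyMonic :
    {P X Y Z Q : Obj} {p₁ : P ⇒ X} {p₂ : P ⇒ Y} {f : X ⇒ Z} {g : Y ⇒ Z} →
    IsPullback C p₁ p₂ f g → {h k : Q ⇒ P} →
    p₁ ∘ h ≈ p₁ ∘ k → p₂ ∘ h ≈ p₂ ∘ k → h ≈ k
  IsPullback-jointlyMonic {p₁ = p₁} {p₂} {f} {g} isPullback {h} {k} eq₁ eq₂ =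
    Eq.trans (unique {eq = square} eq₁ eq₂) (Eq.sym (unique Eq.refl Eq.refl))
    where
      open IsPullback isPullback

      square : f ∘ (p₁ ∘ k) ≈ g ∘ (p₂ ∘ k)
      square = begin
        f ∘ (p₁ ∘ k)  ≈⟨ assoc ⟨
        (f ∘ p₁) ∘ k  ≈⟨ ∘-resp-≈ commute Eq.refl ⟩
        (g ∘ p₂) ∘ k  ≈⟨ assoc ⟩
        g ∘ (p₂ ∘ k)  ∎

  module _ (pullback : {X Y Z : Obj} (f : X ⇒ Z) (g : Y ⇒ Z) → Pullback C f g)
           {A B : Obj} (f : A ⇒ B) where
    private
      module Σ = Functor (composeF C f)
      module Δ = Functor (pullbackF C pullback f)
      module P (Y : SliceObj C B) = Pullback (pullback (SliceObj.arr Y) f)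
    open SliceHom using (hom; triangle)

    -- The second projections agree automatically: they are the triangles.
    pullbackF-hom-ext : {Z : SliceObj C A} (Y : SliceObj C B)
                        (h k : SliceHom C Z (Δ.F₀ Y)) →
                        P.p₁ Y ∘ hom h ≈ P.p₁ Y ∘ hom k → hom h ≈ hom k
    pullbackF-hom-ext Y h k eq =
      IsPullback-jointlyMonic (P.isPullback Y) eq
        (Eq.trans (triangle h) (Eq.sym (triangle k)))

    -- The counit is the first projection of the pullback, so its naturality is the equation
    -- defining `Δ` on arrows. The unit is the section of that projection induced by the identity
    -- and the structure map; being a section is the first triangle identity.
    composeF⊣pullbackF : composeF C f ⊣ pullbackF C pullback f
    composeF⊣pullbackF = record
      { unit   = record { component = η ; commute = η-natural }
      ; counit = record { component = ε ; commute = λ {_} {Y} _ →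
                   P.p₁∘universal≈h₁ Y }
      ; zig    = p₁∘η
      -- After `P.p₁ Y`, naturality of the counit moves `Δ.F₁ (ε Y)` aside and the section law
      -- cancels the unit.
      ; zag    = λ Y → pullbackF-hom-ext Y
                   (Category._∘_ (Slice C A) (Δ.F₁ (ε Y)) (η (Δ.F₀ Y)))
                   (Category.id (Slice C A)) (begin
          P.p₁ Y ∘ (hom (Δ.F₁ (ε Y)) ∘ hom (η (Δ.F₀ Y)))
            ≈⟨ assoc ⟨
          (P.p₁ Y ∘ hom (Δ.F₁ (ε Y))) ∘ hom (η (Δ.F₀ Y))
            ≈⟨ ∘-resp-≈ (P.p₁∘universal≈h₁ Y) Eq.refl ⟩
          (P.p₁ Y ∘ P.p₁ (Σ.F₀ (Δ.F₀ Y))) ∘ hom (η (Δ.F₀ Y))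
            ≈⟨ assoc ⟩
          P.p₁ Y ∘ (P.p₁ (Σ.F₀ (Δ.F₀ Y)) ∘ hom (η (Δ.F₀ Y)))
            ≈⟨ ∘-resp-≈ Eq.refl (p₁∘η (Δ.F₀ Y)) ⟩
          P.p₁ Y ∘ id ∎)
      }
      where
        η : (X : SliceObj C A) → SliceHom C X (Δ.F₀ (Σ.F₀ X))
        -- `identityʳ` is the commuting square for the cone with legs `id` and the structure map of
        -- `X`.
        η X = slicehom {hom = P.universal (Σ.F₀ X) identityʳ}
                       (P.p₂∘universal≈h₂ (Σ.F₀ X))

        p₁∘η : (X : SliceObj C A) → P.p₁ (Σ.F₀ X) ∘ hom (η X) ≈ id
        p₁∘η X = P.p₁∘universal≈h₁ (Σ.F₀ X)

        ε : (Y : SliceObj C B) → SliceHom C (Σ.F₀ (Δ.F₀ Y)) Y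
        ε Y = slicehom (P.commute Y)

        η-natural : {X Y : SliceObj C A} (g : SliceHom C X Y) →
                    hom (η Y) ∘ hom g ≈ hom (Δ.F₁ (Σ.F₁ g)) ∘ hom (η X)
        η-natural {X} {Y} g = pullbackF-hom-ext (Σ.F₀ Y)
          (Category._∘_ (Slice C A) (η Y) g)
          (Category._∘_ (Slice C A) (Δ.F₁ (Σ.F₁ g)) (η X)) (begin
            P.p₁ (Σ.F₀ Y) ∘ (hom (η Y) ∘ hom g)
              ≈⟨ assoc ⟨
            (P.p₁ (Σ.F₀ Y) ∘ hom (η Y)) ∘ hom g
              ≈⟨ ∘-resp-≈ (p₁∘η Y) Eq.refl ⟩
            id ∘ hom g
              ≈⟨ identityˡ ⟩
            hom g
              ≈⟨ identityʳ ⟨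
            hom g ∘ id
              ≈⟨ ∘-resp-≈ Eq.refl (p₁∘η X) ⟨
            hom g ∘ (P.p₁ (Σ.F₀ X) ∘ hom (η X))
              ≈⟨ assoc ⟨
            (hom g ∘ P.p₁ (Σ.F₀ X)) ∘ hom (η X)
              ≈⟨ ∘-resp-≈ (P.p₁∘universal≈h₁ (Σ.F₀ Y)) Eq.refl ⟨
            (P.p₁ (Σ.F₀ Y) ∘ hom (Δ.F₁ (Σ.F₁ g))) ∘ hom (η X)
              ≈⟨ assoc ⟩
            P.p₁ (Σ.F₀ Y) ∘ (hom (Δ.F₁ (Σ.F₁ g)) ∘ hom (η X)) ∎)

mainTheorem13 : ∀ {o ℓ e} (E : Category o ℓ e) (topos : ElementaryTopos E) →
    let open ElementaryTopos topos in
    IsPlainDTT (domF E Ω) (domF E 𝟙) (composeF E true) (pullbackF E pullback true)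
mainTheorem13 E topos = record
  { ctx-terminal = terminal
  ; u-fibration  = domF-isFibration E Ω
  ; u̇-fibration  = domF-isFibration E 𝟙
  ; uΣ≡u̇         = domF∘composeF E true
  ; Σ⊣Δ          = composeF⊣pullbackF E pullback true
  ; Σ-cartesian  = λ φ _ → domF-allCartesian E Ω (composeF.F₁ φ)
  ; Δ-cartesian  = λ φ _ → domF-allCartesian E 𝟙 (pullbackF.F₁ φ)
  ; η-cartesian  = λ X → domF-allCartesian E 𝟙 (η.component X)
  ; ε-cartesian  = λ Y → domF-allCartesian E Ω (ε.component Y)
  }
  where
    open ElementaryTopos topos
    module composeF = Functor (composeF E true)
    module pullbackF = Functor (pullbackF E pullback true)
    open _⊣_ (composeF⊣pullbackF E pullback true)
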